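{- Let $n, m \in \mathbb{N}$ and let $s_1, \dots, s_n$ be positive integers with $s_i \le 2^m$ for all $i$. Let $p_1 < \dots < p_q$ be all the distinct primes dividing at least one of the $s_i$, and write $s_i = \prod_{k=1}^q p_k^{\alpha_{i,k}}$ with $\alpha_{i,k} \in \mathbb{Z}_{\ge 0}$. For each $k \in \{1,\dots,q\}$ put $T_k = \frac{1}{2}\sum_{i=1}^n \alpha_{i,k}$, and assume that $T_k$ is an integer for every $k$. Define $$\hat{s}_i = \sum_{k=1}^q \alpha_{i,k}\, k\, (nm)^{k-1} \quad (1 \le i \le n), \qquad \hat{T} = \sum_{k=1}^q T_k\, k\, (nm)^{k-1}.$$ Then $|\hat{s}_i| \le q^2\, m\, (mn)^q$ for all $i \in \{1,\dots,n\}$, and $q \le 2mn$. Consequently the Subset Sum instance $(\hat{s}_1,\dots,\hat{s}_n;\hat{T})$ has size polynomial in $m,n$: there is a polynomial $p$ in two variables, independent of $n$, $m$ and $s_1,\dots,s_n$, such that the total number of bits in the binary representations of $\hat{s}_1, \dots, \hat{s}_n, \hat{T}$ is at most $p(m,n)$.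
   Context: $\mathbb{N}$ denotes the positive integers. Empty sums equal $0$ and empty products equal $1$. The Subset Sum instance $(\hat{s}_1,\dots,\hat{s}_n;\hat{T})$ asks whether some $x\in\{0,1\}^n$ satisfies $\sum_i x_i\hat{s}_i=\hat{T}$; its size is the number of bits needed to write its numbers. -}

module Defs where

import Algebra.Properties.CommutativeMonoid.Sum as Sum
open import Data.Digit using (Bit; Expansion; fromDigits)
open import Data.Fin.Base as Fin using (Fin; toℕ)
open import Data.Fin.Patterns using (0F; 1F)
open import Data.Integer.Base using (ℤ)
open import Data.Integer.Solver using (module +-*-Solver)
open import Data.List.Base using ([]; _∷_; length)
open import Data.Nat.Base using (ℕ; zero; suc; _+_; _*_; _^_; _≤_; _<_)
open import Data.Nat.Divisibility using (_∣_)
open import Data.Nat.Primality using (Prime)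
open import Data.Nat.Properties using (+-0-commutativeMonoid; *-1-commutativeMonoid)
open import Data.Product.Base using (Σ-syntax; ∃-syntax; _×_)
open import Data.Vec.Base using ([]; _∷_)
open import Data.Vec.Functional using (Vector)
open import Function.Bundles using (_⇔_)
open import Relation.Binary.PropositionalEquality using (_≡_; refl; cong)

∑ : ∀ {n} → Vector ℕ n → ℕ
∑ = Sum.sum +-0-commutativeMonoid

∏ : ∀ {n} → Vector ℕ n → ℕ
∏ = Sum.sum *-1-commutativeMonoid

-- Binary numerals, least significant bit first.  Incrementing starts from
-- the one-digit numeral 0, so binary n never has a superfluous leading
-- zero, and 0 itself takes one bit.

increment : Expansion 2 → Expansion 2
increment []        = 1F ∷ []
increment (0F ∷ bs) = 1F ∷ bs
increment (1F ∷ bs) = 0F ∷ increment bs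

binary : ℕ → Expansion 2
binary zero    = 0F ∷ []
binary (suc n) = increment (binary n)

fromDigits-increment : ∀ bs → fromDigits (increment bs) ≡ suc (fromDigits bs)
fromDigits-increment []        = refl
fromDigits-increment (0F ∷ bs) = refl
fromDigits-increment (1F ∷ bs) rewrite fromDigits-increment bs = refl

fromDigits-binary : ∀ n → fromDigits (binary n) ≡ n
fromDigits-binary zero = refl
fromDigits-binary (suc n)
  rewrite fromDigits-increment (binary n) = cong suc (fromDigits-binary n)

bitLength : ℕ → ℕ
bitLength n = length (binary n)

record SubsetSum (n : ℕ) : Set where
  field
    weight : Vector ℕ n
    target : ℕ

  Solvable : Set
  Solvable = Σ[ x ∈ Vector Bit n ] ∑ (λ i → toℕ (x i) * weight i) ≡ target

  size : ℕ
  size = ∑ (λ i → bitLength (weight i)) + bitLength target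

-- Polynomials in two variables with integer coefficients, as expressions.

Polynomial₂ : Set
Polynomial₂ = +-*-Solver.Polynomial 2

eval₂ : Polynomial₂ → ℤ → ℤ → ℤ
eval₂ P x y = +-*-Solver.⟦ P ⟧ (x ∷ y ∷ [])

record FactoredIntegers (n m : ℕ) : Set where
  field
    s          : Fin n → ℕ
    s-positive : ∀ i → 0 < s i
    s≤2^m      : ∀ i → s i ≤ 2 ^ m

    q            : ℕ
    p            : Fin q → ℕ
    p-increasing : ∀ {k l} → k Fin.< l → p k < p l
    p-primes     : ∀ r → (Prime r × ∃[ i ] r ∣ s i) ⇔ (∃[ k ] p k ≡ r)

    α             : Fin n → Fin q → ℕ
    factorization : ∀ i → s i ≡ ∏ (λ k → p k ^ α i k)

    -- T k is half of ∑ᵢ α i k; its existence in ℕ is the assumption that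
    -- this half is an integer.
    T      : Fin q → ℕ
    T-half : ∀ k → 2 * T k ≡ ∑ (λ i → α i k)

  -- Elements of Fin q count from 0, so the 1-based index is suc (toℕ k),
  -- and the exponent "index minus 1" is toℕ k.

  ŝ : Fin n → ℕ
  ŝ i = ∑ (λ k → α i k * suc (toℕ k) * (n * m) ^ toℕ k)

  T̂ : ℕ
  T̂ = ∑ (λ k → T k * suc (toℕ k) * (n * m) ^ toℕ k)

  subsetSum : SubsetSum n
  subsetSum = record { weight = ŝ ; target = T̂ }

{-# OPTIONS --safe #-}

-- Since every prime is at least 2, 2 ^ ∑ₖ αᵢₖ ≤ sᵢ ≤ 2 ^ m, so each row of
-- exponents sums to at most m and the whole matrix to at most N = n m.
-- Every column contains a nonzero exponent, hence q ≤ N.  All the numbers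
-- of the instance are therefore at most N * (N * N ^ N) ≤ 2 ^ (N * (2 + N)).

module Submission where

open import Defs
import Algebra.Properties.Semiring.Sum as SemiringSum
open import Data.Digit using (Expansion; fromDigits)
open import Data.Empty using (⊥-elim)
open import Data.Fin.Base as Fin using (Fin; zero; suc; toℕ)
open import Data.Fin.Patterns using (0F; 1F)
open import Data.Fin.Properties as Fin using (toℕ<n)
open import Data.Integer.Base as ℤ using (+_)
open import Data.Integer.Properties as ℤ using (pos-*)
open import Data.Integer.Solver using (module +-*-Solver)
open import Data.List.Base using ([]; _∷_; length)
open import Data.Nat.Base using (ℕ; zero; suc; _+_; _*_; _^_; _≤_; _<_; z≤n; s≤s; NonZero; nonTrivial⇒n>1)
open import Data.Nat.Divisibility using (_∣_; ∣1⇒≡1)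
open import Data.Nat.Primality using (Prime; ¬prime[1]; euclidsLemma; prime⇒irreducible; prime⇒nonTrivial)
open import Data.Nat.Properties
open import Data.Product.Base using (∃-syntax; _×_; _,_; proj₁; proj₂; map)
open import Data.Sum.Base using (inj₁; inj₂)
open import Data.Vec.Functional using (Vector)
open import Function.Base using (_∘_; id)
open import Function.Bundles using (module Equivalence)
open import Relation.Binary.Definitions using (tri<; tri≈; tri>)
open import Relation.Binary.PropositionalEquality using (_≡_; refl; sym; cong; subst)

open SemiringSum +-*-semiring using (∑-comm; *-distribʳ-sum)
open ≤-Reasoning

∑-mono : ∀ {n} {f g : Vector ℕ n} → (∀ i → f i ≤ g i) → ∑ f ≤ ∑ g
∑-mono {zero}  f≤g = z≤n
∑-mono {suc n} f≤g = +-mono-≤ (f≤g zero) (∑-mono (f≤g ∘ suc))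

∑-≤-const : ∀ {n c} {f : Vector ℕ n} → (∀ i → f i ≤ c) → ∑ f ≤ n * c
∑-≤-const {zero}  f≤c = z≤n
∑-≤-const {suc n} f≤c = +-mono-≤ (f≤c zero) (∑-≤-const (f≤c ∘ suc))

length≤∑ : ∀ {n} {f : Vector ℕ n} → (∀ i → 0 < f i) → n ≤ ∑ f
length≤∑ {zero}  0<f = z≤n
length≤∑ {suc n} 0<f = +-mono-≤ (0<f zero) (length≤∑ (0<f ∘ suc))

term≤∑ : ∀ {n} (f : Vector ℕ n) i → f i ≤ ∑ f
term≤∑ f zero    = m≤m+n _ _
term≤∑ f (suc i) = ≤-trans (term≤∑ (f ∘ suc) i) (m≤n+m _ _)

-- With `b = 2` and prime `p k`, this turns an upper bound on a number into one on its total
-- exponent.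
^-∑≤∏ : ∀ {n b} {p : Vector ℕ n} (a : Vector ℕ n) → (∀ k → b ≤ p k) →
        b ^ ∑ a ≤ ∏ (λ k → p k ^ a k)
^-∑≤∏ {zero}          a b≤p = ≤-refl
^-∑≤∏ {suc n} {b} {p} a b≤p = begin
  b ^ ∑ a                                             ≡⟨ ^-distribˡ-+-* b (a zero) _ ⟩
  b ^ a zero * b ^ ∑ (a ∘ suc)                        ≤⟨ *-mono-≤ (^-monoˡ-≤ (a zero) (b≤p zero)) (^-∑≤∏ (a ∘ suc) (b≤p ∘ suc)) ⟩
  p zero ^ a zero * ∏ (λ k → p (suc k) ^ a (suc k))  ∎

-- Each weight is at most `q * B ^ q`, because `toℕ k < q` and `B` is at least 1. The vector `a` is
-- arbitrary so that both the rows of `α` and `T` fit.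
∑-weighted≤ : ∀ {q} B .{{_ : NonZero B}} (a : Vector ℕ q) →
              ∑ (λ k → a k * suc (toℕ k) * B ^ toℕ k) ≤ ∑ a * (q * B ^ q)
∑-weighted≤ {q} B a = begin
  ∑ (λ k → a k * suc (toℕ k) * B ^ toℕ k)  ≤⟨ ∑-mono term ⟩
  ∑ (λ k → a k * (q * B ^ q))              ≡⟨ *-distribʳ-sum (q * B ^ q) a ⟨
  ∑ a * (q * B ^ q)                        ∎
  where
  term : ∀ k → a k * suc (toℕ k) * B ^ toℕ k ≤ a k * (q * B ^ q)
  term k = begin
    a k * suc (toℕ k) * B ^ toℕ k    ≡⟨ *-assoc (a k) _ _ ⟩
    a k * (suc (toℕ k) * B ^ toℕ k)  ≤⟨ *-monoʳ-≤ (a k) (*-mono-≤ (toℕ<n k) (^-monoʳ-≤ B (<⇒≤ (toℕ<n k)))) ⟩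
    a k * (q * B ^ q)                ∎

prime>1 : ∀ {p} → Prime p → 1 < p
prime>1 {p} pp = nonTrivial⇒n>1 p {{prime⇒nonTrivial pp}}

prime∤1 : ∀ {r} {A : Set} → Prime r → r ∣ 1 → A
prime∤1 pr r∣1 = ⊥-elim (¬prime[1] (subst Prime (∣1⇒≡1 r∣1) pr))

-- The exponent is positive because `a ^ 0 = 1` has no prime divisor; otherwise Euclid's lemma
-- descends to `a`.
prime∣^ : ∀ {r} → Prime r → ∀ a e → r ∣ a ^ e → r ∣ a × 0 < e
prime∣^ pr a zero    r∣1 = prime∤1 pr r∣1
prime∣^ pr a (suc e) r∣  with euclidsLemma a (a ^ e) pr r∣
... | inj₁ r∣a  = r∣a , s≤s z≤n
... | inj₂ r∣aᵉ = proj₁ (prime∣^ pr a e r∣aᵉ) , s≤s z≤n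

prime∣∏ : ∀ {r n} → Prime r → (f : Vector ℕ n) → r ∣ ∏ f → ∃[ k ] r ∣ f k
prime∣∏ {n = zero}  pr f r∣1 = prime∤1 pr r∣1
prime∣∏ {n = suc n} pr f r∣  with euclidsLemma (f zero) _ pr r∣
... | inj₁ r∣f₀ = zero , r∣f₀
... | inj₂ r∣∏  = map suc id (prime∣∏ pr (f ∘ suc) r∣∏)

prime∣prime : ∀ {r p} → Prime r → Prime p → r ∣ p → r ≡ p
prime∣prime pr pp r∣p with prime⇒irreducible pp r∣p
... | inj₁ r≡1 = ⊥-elim (¬prime[1] (subst Prime r≡1 pr))
... | inj₂ r≡p = r≡p

increasing⇒injective : ∀ {n} {f : Vector ℕ n} → (∀ {k l} → k Fin.< l → f k < f l) →
                       ∀ {k l} → f k ≡ f l → k ≡ l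
increasing⇒injective f-inc {k} {l} eq with Fin.<-cmp k l
... | tri< k<l _ _ = ⊥-elim (<⇒≢ (f-inc k<l) eq)
... | tri≈ _ k≡l _ = k≡l
... | tri> _ _ l<k = ⊥-elim (<⇒≢ (f-inc l<k) (sym eq))

-- Digits run from the least significant, so the leading digit is the last entry of the list. Only
-- such numerals have their length controlled by their value.
data LeadingOne : Expansion 2 → Set where
  [1] : LeadingOne (1F ∷ [])
  _∷_ : ∀ b {bs} → LeadingOne bs → LeadingOne (b ∷ bs)

increment-leadingOne : ∀ {bs} → LeadingOne bs → LeadingOne (increment bs)
increment-leadingOne [1]       = 0F ∷ [1]
increment-leadingOne (0F ∷ bs) = 1F ∷ bs
increment-leadingOne (1F ∷ bs) = 0F ∷ increment-leadingOne bs

binary-leadingOne : ∀ n → LeadingOne (binary (suc n))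
binary-leadingOne zero    = [1]
binary-leadingOne (suc n) = increment-leadingOne (binary-leadingOne n)

-- The leading one alone contributes `2 ^ (length bs - 1)`; doubling both sides avoids the
-- subtraction.
2^length≤ : ∀ {bs} → LeadingOne bs → 2 ^ length bs ≤ 2 * fromDigits bs
2^length≤ [1] = ≤-refl
2^length≤ (_∷_ b {bs} one) = *-monoʳ-≤ 2 (begin
  2 ^ length bs               ≤⟨ 2^length≤ one ⟩
  2 * fromDigits bs           ≡⟨ *-comm 2 (fromDigits bs) ⟩
  fromDigits bs * 2           ≤⟨ m≤n+m _ (toℕ b) ⟩
  toℕ b + fromDigits bs * 2   ∎)

2^-cancel-≤ : ∀ {a b} → 2 ^ a ≤ 2 ^ b → a ≤ b
2^-cancel-≤ le = ≮⇒≥ (λ b<a → <⇒≱ (^-monoʳ-< 2 ≤-refl b<a) le)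

-- The extra bit is attained at `x = 2 ^ e`. Zero is treated apart, since its one-digit numeral has
-- no leading one.
bitLength≤ : ∀ {x e} → x ≤ 2 ^ e → bitLength x ≤ suc e
bitLength≤ {zero}      _  = s≤s z≤n
bitLength≤ {suc x} {e} le = 2^-cancel-≤ (begin
  2 ^ bitLength (suc x)                ≤⟨ 2^length≤ (binary-leadingOne x) ⟩
  2 * fromDigits (binary (suc x))      ≡⟨ cong (2 *_) (fromDigits-binary (suc x)) ⟩
  2 * suc x                            ≤⟨ *-monoʳ-≤ 2 le ⟩
  2 ^ suc e                            ∎)

n≤2^n : ∀ n → n ≤ 2 ^ n
n≤2^n zero    = z≤n
n≤2^n (suc n) = begin
  1 + n              ≤⟨ +-mono-≤ (m^n>0 2 n) (n≤2^n n) ⟩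
  2 ^ n + 2 ^ n      ≡⟨ cong (λ t → 2 ^ n + t) (+-identityʳ _) ⟨
  2 ^ suc n          ∎

n≤n^2 : ∀ n → n ≤ n ^ 2
n≤n^2 zero      = z≤n
n≤n^2 n@(suc _) = m≤m*n n (n ^ 1) {{m^n≢0 n 1}}

module Bounds {n m : ℕ} .{{_ : NonZero n}} .{{_ : NonZero m}} (S : FactoredIntegers n m) where
  open FactoredIntegers S

  N : ℕ
  N = n * m

  instance
    N≢0 : NonZero N
    N≢0 = m*n≢0 n m

  p-prime : ∀ k → Prime (p k)
  p-prime k = proj₁ (Equivalence.from (p-primes (p k)) (k , refl))

  ∑α≤m : ∀ i → ∑ (α i) ≤ m
  ∑α≤m i = 2^-cancel-≤ (begin
    2 ^ ∑ (α i)              ≤⟨ ^-∑≤∏ (α i) (prime>1 ∘ p-prime) ⟩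
    ∏ (λ k → p k ^ α i k)    ≡⟨ factorization i ⟨
    s i                      ≤⟨ s≤2^m i ⟩
    2 ^ m                    ∎)

  -- By Euclid's lemma `p k` divides some `p l` with `0 < α i l`. Both are prime, hence equal, and
  -- strict monotonicity of `p` forces `k = l`.
  p∣s⇒0<α : ∀ i k → p k ∣ s i → 0 < α i k
  p∣s⇒0<α i k pₖ∣s
    with l , pₖ∣pₗ^α ← prime∣∏ (p-prime k) _ (subst (p k ∣_) (factorization i) pₖ∣s)
    with pₖ∣pₗ , 0<α ← prime∣^ (p-prime k) (p l) (α i l) pₖ∣pₗ^α
    with refl ← increasing⇒injective p-increasing {k} {l} (prime∣prime (p-prime k) (p-prime l) pₖ∣pₗ)
    = 0<α

  -- By `p-primes`, `p k` divides some `s i`, and that row puts a positive entry in the column.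
  0<column : ∀ k → 0 < ∑ (λ i → α i k)
  0<column k with i , pₖ∣s ← proj₂ (Equivalence.from (p-primes (p k)) (k , refl))
    = ≤-trans (p∣s⇒0<α i k pₖ∣s) (term≤∑ (λ i → α i k) i)

  ∑∑α≤N : ∑ (λ k → ∑ (λ i → α i k)) ≤ N
  ∑∑α≤N = begin
    -- Double counting: the row bounds control the sum of the column sums.
    ∑ (λ k → ∑ (λ i → α i k))  ≡⟨ ∑-comm α ⟨
    ∑ (λ i → ∑ (α i))          ≤⟨ ∑-≤-const ∑α≤m ⟩
    N                          ∎

  q≤N : q ≤ N
  q≤N = ≤-trans (length≤∑ 0<column) ∑∑α≤N

  ∑T≤N : ∑ T ≤ N
  ∑T≤N = ≤-trans (∑-mono T≤column) ∑∑α≤N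
    where
    T≤column : ∀ k → T k ≤ ∑ (λ i → α i k)
    T≤column k = ≤-trans (m≤n*m (T k) 2) (≤-reflexive (T-half k))

  q≤2mn : q ≤ 2 * m * n
  q≤2mn = begin
    q            ≤⟨ q≤N ⟩
    n * m        ≡⟨ *-comm n m ⟩
    m * n        ≤⟨ *-monoˡ-≤ n (m≤n*m m 2) ⟩
    2 * m * n    ∎

  ŝ≤ : ∀ i → ŝ i ≤ q ^ 2 * m * (m * n) ^ q
  ŝ≤ i = begin
    ŝ i                        ≤⟨ ∑-weighted≤ N (α i) ⟩
    -- The estimate holds with a single factor `q`, weakened here to the stated `q ^ 2`.
    ∑ (α i) * (q * N ^ q)      ≤⟨ *-mono-≤ (∑α≤m i) (*-monoˡ-≤ (N ^ q) (n≤n^2 q)) ⟩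
    m * (q ^ 2 * N ^ q)        ≡⟨ *-assoc m (q ^ 2) (N ^ q) ⟨
    m * q ^ 2 * N ^ q          ≡⟨ cong (_* N ^ q) (*-comm m (q ^ 2)) ⟩
    q ^ 2 * m * N ^ q          ≡⟨ cong (λ b → q ^ 2 * m * b ^ q) (*-comm n m) ⟩
    q ^ 2 * m * (m * n) ^ q    ∎

  weighted≤2^ : (a : Vector ℕ q) → ∑ a ≤ N →
                ∑ (λ k → a k * suc (toℕ k) * N ^ toℕ k) ≤ 2 ^ (N * (2 + N))
  weighted≤2^ a ∑a≤N = begin
    ∑ (λ k → a k * suc (toℕ k) * N ^ toℕ k)  ≤⟨ ∑-weighted≤ N a ⟩
    -- The resulting `N * (N * N ^ N)` is `N ^ (2 + N)` by computation.
    ∑ a * (q * N ^ q)                        ≤⟨ *-mono-≤ ∑a≤N (*-mono-≤ q≤N (^-monoʳ-≤ N q≤N)) ⟩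
    N ^ (2 + N)                              ≤⟨ ^-monoˡ-≤ (2 + N) (n≤2^n N) ⟩
    (2 ^ N) ^ (2 + N)                        ≡⟨ ^-*-assoc 2 N (2 + N) ⟩
    2 ^ (N * (2 + N))                        ∎

  size≤ : SubsetSum.size subsetSum ≤ n * (1 + N * (2 + N)) + (1 + N * (2 + N))
  size≤ = +-mono-≤
    (∑-≤-const (λ i → bitLength≤ (weighted≤2^ (α i) (≤-trans (∑α≤m i) (m≤n*m m n)))))
    (bitLength≤ (weighted≤2^ T ∑T≤N))

-- The bound of `size≤` as an expression: `c` bounds the bits of one number, and there are `n`
-- weights and one target. Variable 0 is `m` and variable 1 is `n`.
sizeBound : Polynomial₂
sizeBound = n :* c :+ c
  where
  open +-*-Solver
  m n c : Polynomial₂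
  m = var 0F
  n = var 1F
  c = con (+ 1) :+ (n :* m) :* (con (+ 2) :+ n :* m)

-- Sums of embedded naturals reduce by computation, so only the three products are rewritten,
-- innermost first.
eval-sizeBound : ∀ n m → eval₂ sizeBound (+ m) (+ n) ≡
                 + (n * (1 + n * m * (2 + n * m)) + (1 + n * m * (2 + n * m)))
eval-sizeBound n m
  rewrite sym (pos-* n m)
        | sym (pos-* (n * m) (2 + n * m))
        | sym (pos-* n (1 + n * m * (2 + n * m)))
        = refl

mainTheorem3 : (∀ (n m : ℕ) .{{_ : NonZero n}} .{{_ : NonZero m}} (S : FactoredIntegers n m) →
    let open FactoredIntegers S in
    (∀ i → ŝ i ≤ q ^ 2 * m * (m * n) ^ q) × q ≤ 2 * m * n)
    ×
    (∃[ P ] (∀ (n m : ℕ) .{{_ : NonZero n}} .{{_ : NonZero m}} (S : FactoredIntegers n m) →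
    + SubsetSum.size (FactoredIntegers.subsetSum S) ℤ.≤ eval₂ P (+ m) (+ n)))
mainTheorem3 =
  (λ n m S → Bounds.ŝ≤ S , Bounds.q≤2mn S) ,
  sizeBound ,
  (λ n m S → ℤ.≤-trans (ℤ.+≤+ (Bounds.size≤ S)) (ℤ.≤-reflexive (sym (eval-sizeBound n m))))
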